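{- The hypersequent calculus $\mathsf{GR}_H$ and the axiomatic system $\mathsf{GR}_{AX}$ specified in the context are equivalent with respect to derivability: for every formula $A$ of the bimodal language with $\Box$ and $\blacksquare$, $A$ is provable in $\mathsf{GR}_{AX}$ if and only if the (one-component) hypersequent $\to A$ is provable in $\mathsf{GR}_H$.
   Context: **Formulas.** $A ::= p \mid \bot \mid \neg A \mid A\wedge A \mid \blacksquare A \mid \Box A$, where $p$ ranges over propositional variables. Other connectives are abbreviations defined from $\wedge,\neg$ (e.g. $A\vee B:=\neg(\neg A\wedge\neg B)$, $A\supset B:=\neg(A\wedge\neg B)$), and $\Diamond A:=\neg\Box\neg A$. **The axiomatic system $\mathsf{GR}_{AX}$.** Axioms (all instances of): 1. axioms of classical propositional logic; 2. $\Box(A\supset B)\supset(\Box A\supset\Box B)$; 3. $\Box(\Box A\supset A)\supset\Box A$; 4. $\blacksquare A\supset\Box A$; 5. $\Box A\supset\Box\blacksquare A$; 6. $\Box A\supset(\Box\bot\vee\blacksquare A)$; 7. $\Diamond\blacksquare A\supset\Diamond A$. Inference rules: from $A$ and $A\supset B$ infer $B$; from $A$ infer $\Box A$; from $\Box A$ infer $A$. **Sequents and hypersequents.** $\Gamma,\Delta,\Pi,\Theta$ denote finite (possibly empty) multisets of formulas. There are two sorts of sequents: $\to$-sequents $\Gamma\to\Delta$ and $\Rightarrow$-sequents $\Gamma\Rightarrow\Delta$. A hypersequent is a finite expression $S_1\mid S_2\mid\cdots\mid S_n$ of sequents of either sort, identified with all its permutations (i.e. a finite multiset of sequents). In the rules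 below, the side hypersequents ${\cal H},{\cal I}$ are arbitrary and possibly empty. The symbol $\gg$ stands for either $\to$ or $\Rightarrow$, uniformly the same throughout one instance of a rule. We write "premise(s) $/$ conclusion". **The hypersequent calculus $\mathsf{GR}_H$.** A proof is a finite tree built from initial sequents by the rules. Initial sequents: $A\to A$ (for every formula $A$) and $\bot\to$. Propositional rules: - $(\wedge{:}l)$ ${\cal H}\mid A,\Gamma\gg\Delta \;/\; {\cal H}\mid A\wedge B,\Gamma\gg\Delta$; and ${\cal H}\mid B,\Gamma\gg\Delta \;/\; {\cal H}\mid A\wedge B,\Gamma\gg\Delta$. - $(\wedge{:}r)$ ${\cal H}\mid\Gamma\gg\Delta,A$ and ${\cal I}\mid\Pi\gg\Theta,B \;/\; {\cal H}\mid{\cal I}\mid\Gamma,\Pi\gg\Delta,\Theta,A\wedge B$. - $(\neg{:}l)$ ${\cal H}\mid\Gamma\gg\Delta,A \;/\; {\cal H}\mid\neg A,\Gamma\gg\Delta$. - $(\neg{:}r)$ ${\cal H}\mid A,\Gamma\gg\Delta \;/\; {\cal H}\mid\Gamma\gg\Delta,\neg A$. Internal structural rules: - $(ic)$ ${\cal H}\mid A,A,\Gamma\gg\Delta \;/\; {\cal H}\mid A,\Gamma\gg\Delta$; and ${\cal H}\mid\Gamma\gg\Delta,A,A \;/\; {\cal H}\mid\Gamma\gg\Delta,A$. - $(iw)$ ${\cal H}\mid\Gamma\gg\Delta \;/\; {\cal H}\mid A,\Gamma\gg\Delta$; and ${\cal H}\mid\Gamma\gg\Delta \;/\; {\cal H}\mid\Gamma\gg\Delta,A$.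 - $(cut)$ ${\cal H}\mid\Gamma\gg\Delta,A$ and ${\cal I}\mid A,\Pi\gg\Theta \;/\; {\cal H}\mid{\cal I}\mid\Gamma,\Pi\gg\Delta,\Theta$. External structural rules: - $(ew)$ ${\cal H} \;/\; {\cal H}\mid S$, for any sequent $S$ of either sort (here the premise ${\cal H}$ is a hypersequent, hence nonempty). - $(split)$ ${\cal H}\mid\Gamma,\Theta\to\Delta,\Pi \;/\; {\cal H}\mid\Gamma\to\Delta\mid\Theta\to\Pi$. - $(merge)$ ${\cal H}\mid\Gamma\gg\Delta\mid\Theta\gg\Pi \;/\; {\cal H}\mid\Gamma,\Theta\gg\Delta,\Pi$. - $(\bot)$ ${\cal H}\mid\Gamma\Rightarrow\Delta\mid\ \to\ \;/\; {\cal H}\mid\Gamma\Rightarrow\Delta$ (here "$\to$" is the empty $\to$-sequent). Modal rules: - $(K)$ ${\cal H}\mid A,\Gamma\Rightarrow\Delta \;/\; {\cal H}\mid\Box A\to\ \mid\Gamma\Rightarrow\Delta$. - $(4)$ ${\cal H}\mid\Box A,\Gamma\Rightarrow\Delta \;/\; {\cal H}\mid\Box A\to\ \mid\Gamma\Rightarrow\Delta$. - $(\Box{:}r)$ ${\cal H}\mid\Box A\Rightarrow A \;/\; {\cal H}\mid\ \to\Box A$. - $(K^\blacksquare)$ ${\cal H}\mid A,\Gamma\Rightarrow\Delta \;/\; {\cal H}\mid\blacksquare A\to\ \mid\Gamma\Rightarrow\Delta$. - $(4^\blacksquare)$ ${\cal H}\mid\blacksquare A,\Gamma\Rightarrow\Delta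 \;/\; {\cal H}\mid\blacksquare A\to\ \mid\Gamma\Rightarrow\Delta$. - $(\blacksquare{:}r_1)$ ${\cal H}\mid\Box A\Rightarrow A \;/\; {\cal H}\mid\ \to\blacksquare A\mid\ \Rightarrow\ $ (the last component is the empty $\Rightarrow$-sequent). - $(\blacksquare{:}l)$ ${\cal H}\mid A\Rightarrow\ \;/\; {\cal H}\mid\blacksquare A\Rightarrow\ $. - $(\blacksquare{:}r_2)$ ${\cal H}\mid\ \Rightarrow A \;/\; {\cal H}\mid\ \Rightarrow\blacksquare A$. Modal structural rules (premise and conclusion consist of a single sequent, with no side hypersequent): - $(\Rightarrow)$ $\Gamma\to\Delta \;/\; \Gamma\Rightarrow\Delta$. - $(\to)$ $\Gamma\Rightarrow\Delta \;/\; \Gamma\to\Delta$. -}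

module Defs where

open import Data.Bool as Bool using (Bool; true; false)
open import Data.List using (List; []; _∷_; _++_; [_])
open import Data.List.Relation.Binary.Permutation.Homogeneous using (Permutation)
open import Data.List.Relation.Binary.Permutation.Propositional using (_↭_)
open import Data.Nat using (ℕ)
open import Relation.Binary.PropositionalEquality using (_≡_)

infix  30 ¬_ ■_ □_ ◇_
infixr 25 _∧_
infixr 24 _∨_
infixr 23 _⊃_

data Formula : Set where
  var : ℕ → Formula
  ⊥   : Formula
  ¬_  : Formula → Formula
  _∧_ : Formula → Formula → Formula
  ■_  : Formula → Formula
  □_  : Formula → Formula

_∨_ _⊃_ : Formula → Formula → Formula
A ∨ B = ¬ (¬ A ∧ ¬ B)
A ⊃ B = ¬ (A ∧ ¬ B)

◇_ : Formula → Formula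
◇ A = ¬ (□ (¬ A))

-- Only the values of v at variables and at formulas of the form ■ A or □ A
-- are used: propositional logic sees the latter as further atoms.
eval : (Formula → Bool) → Formula → Bool
eval v (var p) = v (var p)
eval v ⊥       = false
eval v (¬ A)   = Bool.not (eval v A)
eval v (A ∧ B) = eval v A Bool.∧ eval v B
eval v (■ A)   = v (■ A)
eval v (□ A)   = v (□ A)

Tautology : Formula → Set
Tautology A = ∀ v → eval v A ≡ true

infix 4 ⊢AX_

-- The axioms of classical propositional logic are taken to be all formulas of
-- the bimodal language that are instances of classical tautologies.
data ⊢AX_ : Formula → Set where
  taut : ∀ {A} → Tautology A → ⊢AX A
  ax2  : ∀ A B → ⊢AX □ (A ⊃ B) ⊃ (□ A ⊃ □ B)
  ax3  : ∀ A → ⊢AX □ (□ A ⊃ A) ⊃ □ A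
  ax4  : ∀ A → ⊢AX ■ A ⊃ □ A
  ax5  : ∀ A → ⊢AX □ A ⊃ □ (■ A)
  ax6  : ∀ A → ⊢AX □ A ⊃ (□ ⊥ ∨ ■ A)
  ax7  : ∀ A → ⊢AX ◇ (■ A) ⊃ ◇ A
  mp   : ∀ {A B} → ⊢AX A → ⊢AX A ⊃ B → ⊢AX B
  nec  : ∀ {A} → ⊢AX A → ⊢AX □ A
  den  : ∀ {A} → ⊢AX □ A → ⊢AX A

data Arrow : Set where
  single double : Arrow

infix 10 _⟨_⟩_ _⟶_ _⟹_

-- The two sides of a sequent are multisets, represented by lists; see _≈_.
data Sequent : Set where
  _⟨_⟩_ : List Formula → Arrow → List Formula → Sequent

pattern _⟶_ Γ Δ = Γ ⟨ single ⟩ Δ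
pattern _⟹_ Γ Δ = Γ ⟨ double ⟩ Δ

Hypersequent : Set
Hypersequent = List Sequent

infixl 6 _∣_

_∣_ : Hypersequent → Sequent → Hypersequent
H ∣ S = S ∷ H

infix 4 _≈_ _≋_

data _≈_ : Sequent → Sequent → Set where
  perm : ∀ {Γ Γ′ Δ Δ′} a → Γ ↭ Γ′ → Δ ↭ Δ′ → Γ ⟨ a ⟩ Δ ≈ Γ′ ⟨ a ⟩ Δ′

-- Two lists of sequents represent the same hypersequent when they agree up to
-- reordering components and reordering formulas within the sides of each one.
_≋_ : Hypersequent → Hypersequent → Set
_≋_ = Permutation _≈_

infix 4 ⊢H_

-- exch only changes the list representing a given multiset.  The empty list is
-- not a hypersequent, but it has no derivation (every rule has a nonempty
-- conclusion if its premises are nonempty), so the premise of ew is nonempty.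
data ⊢H_ : Hypersequent → Set where
  exch : ∀ {H H′} → H ≋ H′ → ⊢H H → ⊢H H′

  init : ∀ A → ⊢H [ [ A ] ⟶ [ A ] ]
  ⊥-l  : ⊢H [ [ ⊥ ] ⟶ [] ]

  ∧-l₁ : ∀ {H a A B Γ Δ} →
         ⊢H H ∣ (A ∷ Γ) ⟨ a ⟩ Δ →
         ⊢H H ∣ (A ∧ B ∷ Γ) ⟨ a ⟩ Δ
  ∧-l₂ : ∀ {H a A B Γ Δ} →
         ⊢H H ∣ (B ∷ Γ) ⟨ a ⟩ Δ →
         ⊢H H ∣ (A ∧ B ∷ Γ) ⟨ a ⟩ Δ
  ∧-r  : ∀ {H I a A B Γ Δ Π Θ} →
         ⊢H H ∣ Γ ⟨ a ⟩ (A ∷ Δ) →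
         ⊢H I ∣ Π ⟨ a ⟩ (B ∷ Θ) →
         ⊢H (H ++ I) ∣ (Γ ++ Π) ⟨ a ⟩ (A ∧ B ∷ Δ ++ Θ)
  ¬-l  : ∀ {H a A Γ Δ} →
         ⊢H H ∣ Γ ⟨ a ⟩ (A ∷ Δ) →
         ⊢H H ∣ (¬ A ∷ Γ) ⟨ a ⟩ Δ
  ¬-r  : ∀ {H a A Γ Δ} →
         ⊢H H ∣ (A ∷ Γ) ⟨ a ⟩ Δ →
         ⊢H H ∣ Γ ⟨ a ⟩ (¬ A ∷ Δ)

  ic-l : ∀ {H a A Γ Δ} →
         ⊢H H ∣ (A ∷ A ∷ Γ) ⟨ a ⟩ Δ →
         ⊢H H ∣ (A ∷ Γ) ⟨ a ⟩ Δ
  ic-r : ∀ {H a A Γ Δ} →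
         ⊢H H ∣ Γ ⟨ a ⟩ (A ∷ A ∷ Δ) →
         ⊢H H ∣ Γ ⟨ a ⟩ (A ∷ Δ)
  iw-l : ∀ {H a A Γ Δ} →
         ⊢H H ∣ Γ ⟨ a ⟩ Δ →
         ⊢H H ∣ (A ∷ Γ) ⟨ a ⟩ Δ
  iw-r : ∀ {H a A Γ Δ} →
         ⊢H H ∣ Γ ⟨ a ⟩ Δ →
         ⊢H H ∣ Γ ⟨ a ⟩ (A ∷ Δ)
  cut  : ∀ {H I a A Γ Δ Π Θ} →
         ⊢H H ∣ Γ ⟨ a ⟩ (A ∷ Δ) →
         ⊢H I ∣ (A ∷ Π) ⟨ a ⟩ Θ →
         ⊢H (H ++ I) ∣ (Γ ++ Π) ⟨ a ⟩ (Δ ++ Θ)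

  ew    : ∀ {H} S → ⊢H H → ⊢H H ∣ S
  split : ∀ {H Γ Δ Θ Π} →
          ⊢H H ∣ (Γ ++ Θ) ⟶ (Δ ++ Π) →
          ⊢H H ∣ Γ ⟶ Δ ∣ Θ ⟶ Π
  merge : ∀ {H a Γ Δ Θ Π} →
          ⊢H H ∣ Γ ⟨ a ⟩ Δ ∣ Θ ⟨ a ⟩ Π →
          ⊢H H ∣ (Γ ++ Θ) ⟨ a ⟩ (Δ ++ Π)
  ⊥-ext : ∀ {H Γ Δ} →
          ⊢H H ∣ Γ ⟹ Δ ∣ [] ⟶ [] →
          ⊢H H ∣ Γ ⟹ Δ

  □-K  : ∀ {H A Γ Δ} →
         ⊢H H ∣ (A ∷ Γ) ⟹ Δ →
         ⊢H H ∣ [ □ A ] ⟶ [] ∣ Γ ⟹ Δ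
  □-4  : ∀ {H A Γ Δ} →
         ⊢H H ∣ (□ A ∷ Γ) ⟹ Δ →
         ⊢H H ∣ [ □ A ] ⟶ [] ∣ Γ ⟹ Δ
  □-r  : ∀ {H A} →
         ⊢H H ∣ [ □ A ] ⟹ [ A ] →
         ⊢H H ∣ [] ⟶ [ □ A ]
  ■-K  : ∀ {H A Γ Δ} →
         ⊢H H ∣ (A ∷ Γ) ⟹ Δ →
         ⊢H H ∣ [ ■ A ] ⟶ [] ∣ Γ ⟹ Δ
  ■-4  : ∀ {H A Γ Δ} →
         ⊢H H ∣ (■ A ∷ Γ) ⟹ Δ →
         ⊢H H ∣ [ ■ A ] ⟶ [] ∣ Γ ⟹ Δ
  ■-r₁ : ∀ {H A} →
         ⊢H H ∣ [ □ A ] ⟹ [ A ] →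
         ⊢H H ∣ [] ⟶ [ ■ A ] ∣ [] ⟹ []
  ■-l  : ∀ {H A} →
         ⊢H H ∣ [ A ] ⟹ [] →
         ⊢H H ∣ [ ■ A ] ⟹ []
  ■-r₂ : ∀ {H A} →
         ⊢H H ∣ [] ⟹ [ A ] →
         ⊢H H ∣ [] ⟹ [ ■ A ]

  to-⟹ : ∀ {Γ Δ} → ⊢H [ Γ ⟶ Δ ] → ⊢H [ Γ ⟹ Δ ]
  to-⟶ : ∀ {Γ Δ} → ⊢H [ Γ ⟹ Δ ] → ⊢H [ Γ ⟶ Δ ]

{-# OPTIONS --safe #-}

-- A hypersequent is read in GR_AX as the disjunction of its components, where
-- Γ ⟶ Δ stands for ⋀ Γ ⊃ ⋁ Δ and Γ ⟹ Δ for □ (⋀ Γ ⊃ ⋁ Δ).  Under this reading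
-- each rule of GR_H preserves provability; (■:r₁) is Löb's axiom followed by
-- axiom 6, the empty ⟹-component being □ ⊥.  Conversely, tautologies are derived
-- in GR_H by Kalmár's argument, cutting on atoms, and the modal axioms directly.
module Submission where

open import Data.Bool as Bool using (Bool; true; false; T; if_then_else_)
open import Data.Bool.Properties using (T-≡; T-∧)
open import Data.Empty using (⊥-elim)
open import Data.List using (List; []; [_]; _∷_; _++_; map)
open import Data.List.Membership.Propositional using (_∈_)
open import Data.List.Membership.Propositional.Properties
  using (∈-∃++; ∈-++⁺ʳ; ∈-++⁻)
open import Data.List.Relation.Binary.Permutation.Homogeneous as Homogeneous using ()
open import Data.List.Relation.Binary.Permutation.Propositional as ↭ using (_↭_)
open import Data.List.Relation.Binary.Permutation.Propositional.Properties
  using (++-comm; shift; All-resp-↭; Any-resp-↭)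
open import Data.List.Relation.Binary.Pointwise as Pointwise using (Pointwise; []; _∷_)
open import Data.List.Relation.Binary.Subset.Propositional using (_⊆_)
open import Data.List.Relation.Unary.All as All using (All; []; _∷_)
import Data.List.Relation.Unary.All.Properties as All
open import Data.List.Relation.Unary.Any as Any using (Any; here; there)
import Data.List.Relation.Unary.Any.Properties as Any
open import Data.Nat using (_≡ᵇ_)
open import Data.Nat.Properties using (≡ᵇ⇒≡; ≡⇒≡ᵇ)
open import Data.Product using (_,_; proj₁; proj₂)
open import Data.Sum as Sum using (_⊎_; inj₁; inj₂; [_,_]′)
open import Function using (_∘_; id; case_of_)
open import Function.Bundles using (_⇔_; mk⇔; module Equivalence)
open import Relation.Binary.Definitions using (DecidableEquality)
open import Relation.Binary.PropositionalEquality using (_≡_; refl; cong; cong₂; subst)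
open import Relation.Nullary using (yes; no; does)
open import Relation.Nullary.Decidable using (map′)
open import Defs

-- Structural rules of GR_H

≈-refl : ∀ {S} → S ≈ S
≈-refl {Γ ⟨ a ⟩ Δ} = perm a ↭.refl ↭.refl

≋-refl : ∀ {H} → H ≋ H
≋-refl = Homogeneous.refl (Pointwise.refl ≈-refl)

swap : ∀ {H S T} → ⊢H H ∣ S ∣ T → ⊢H H ∣ T ∣ S
swap = exch (Homogeneous.swap ≈-refl ≈-refl ≋-refl)

reorder : ∀ {H a Γ Γ′ Δ Δ′} → Γ ↭ Γ′ → Δ ↭ Δ′ →
          ⊢H H ∣ Γ ⟨ a ⟩ Δ → ⊢H H ∣ Γ′ ⟨ a ⟩ Δ′
reorder p q = exch (Homogeneous.prep (perm _ p q) ≋-refl)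

weaken-l : ∀ Θ {H a Γ Δ} → ⊢H H ∣ Γ ⟨ a ⟩ Δ → ⊢H H ∣ (Θ ++ Γ) ⟨ a ⟩ Δ
weaken-l []      d = d
weaken-l (A ∷ Θ) d = iw-l (weaken-l Θ d)

weaken-r : ∀ Θ {H a Γ Δ} → ⊢H H ∣ Γ ⟨ a ⟩ Δ → ⊢H H ∣ Γ ⟨ a ⟩ (Θ ++ Δ)
weaken-r []      d = d
weaken-r (A ∷ Θ) d = iw-r (weaken-r Θ d)

absorb-l : ∀ {H a A Γ Δ} → A ∈ Γ → ⊢H H ∣ (A ∷ Γ) ⟨ a ⟩ Δ → ⊢H H ∣ Γ ⟨ a ⟩ Δ
absorb-l A∈Γ d with ∈-∃++ A∈Γ
... | Γ₁ , Γ₂ , refl =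
  reorder (↭.↭-sym (shift _ Γ₁ Γ₂)) ↭.refl
    (ic-l (reorder (↭.prep _ (shift _ Γ₁ Γ₂)) ↭.refl d))

absorb-r : ∀ {H a A Γ Δ} → A ∈ Δ → ⊢H H ∣ Γ ⟨ a ⟩ (A ∷ Δ) → ⊢H H ∣ Γ ⟨ a ⟩ Δ
absorb-r A∈Δ d with ∈-∃++ A∈Δ
... | Δ₁ , Δ₂ , refl =
  reorder ↭.refl (↭.↭-sym (shift _ Δ₁ Δ₂))
    (ic-r (reorder ↭.refl (↭.prep _ (shift _ Δ₁ Δ₂)) d))

contract-l : ∀ Θ {H a Γ Δ} → Θ ⊆ Γ → ⊢H H ∣ (Θ ++ Γ) ⟨ a ⟩ Δ → ⊢H H ∣ Γ ⟨ a ⟩ Δ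
contract-l []      Θ⊆Γ d = d
contract-l (A ∷ Θ) Θ⊆Γ d =
  contract-l Θ (Θ⊆Γ ∘ there) (absorb-l (∈-++⁺ʳ Θ (Θ⊆Γ (here refl))) d)

contract-r : ∀ Θ {H a Γ Δ} → Θ ⊆ Δ → ⊢H H ∣ Γ ⟨ a ⟩ (Θ ++ Δ) → ⊢H H ∣ Γ ⟨ a ⟩ Δ
contract-r []      Θ⊆Δ d = d
contract-r (A ∷ Θ) Θ⊆Δ d =
  contract-r Θ (Θ⊆Δ ∘ there) (absorb-r (∈-++⁺ʳ Θ (Θ⊆Δ (here refl))) d)

-- Weakening by all of `Γ′` and `Δ′` turns every formula of `Γ` and `Δ` into a duplicate, which
-- contraction removes. Multiplicities never have to be compared.
structural : ∀ {H a Γ Γ′ Δ Δ′} → Γ ⊆ Γ′ → Δ ⊆ Δ′ →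
             ⊢H H ∣ Γ ⟨ a ⟩ Δ → ⊢H H ∣ Γ′ ⟨ a ⟩ Δ′
structural {Γ = Γ} {Γ′} {Δ} {Δ′} Γ⊆Γ′ Δ⊆Δ′ d =
  contract-r Δ Δ⊆Δ′ (contract-l Γ Γ⊆Γ′
    (reorder (++-comm Γ′ Γ) (++-comm Δ′ Δ) (weaken-r Δ′ (weaken-l Γ′ d))))

++-idem : ∀ (Γ : List Formula) → Γ ++ Γ ⊆ Γ
++-idem Γ = [ id , id ]′ ∘ ∈-++⁻ Γ

-- The context-sharing form, as a truth-table argument needs it: the doubled context is contracted.
∧-r⁺ : ∀ {a A B Γ Δ} → ⊢H [ Γ ⟨ a ⟩ (A ∷ Δ) ] → ⊢H [ Γ ⟨ a ⟩ (B ∷ Δ) ] →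
       ⊢H [ Γ ⟨ a ⟩ (A ∧ B ∷ Δ) ]
∧-r⁺ {Γ = Γ} {Δ} d e =
  structural (++-idem Γ) (λ { (here p) → here p ; (there p) → there (++-idem Δ p) })
    (∧-r d e)

cut⁺ : ∀ {a A Γ Δ} → ⊢H [ Γ ⟨ a ⟩ (A ∷ Δ) ] → ⊢H [ (A ∷ Γ) ⟨ a ⟩ Δ ] → ⊢H [ Γ ⟨ a ⟩ Δ ]
cut⁺ {Γ = Γ} {Δ} d e = structural (++-idem Γ) (++-idem Δ) (cut d e)

∧-l : ∀ {H a A B Γ Δ} → ⊢H H ∣ (A ∷ B ∷ Γ) ⟨ a ⟩ Δ → ⊢H H ∣ (A ∧ B ∷ Γ) ⟨ a ⟩ Δ
∧-l d = ic-l (∧-l₂ (reorder (↭.swap _ _ ↭.refl) ↭.refl (∧-l₁ d)))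

⊃-r : ∀ {H a A B Γ Δ} → ⊢H H ∣ (A ∷ Γ) ⟨ a ⟩ (B ∷ Δ) → ⊢H H ∣ Γ ⟨ a ⟩ (A ⊃ B ∷ Δ)
⊃-r d = ¬-r (∧-l (reorder (↭.swap _ _ ↭.refl) ↭.refl (¬-l d)))

∨-r : ∀ {H a A B Γ Δ} → ⊢H H ∣ Γ ⟨ a ⟩ (B ∷ A ∷ Δ) → ⊢H H ∣ Γ ⟨ a ⟩ (A ∨ B ∷ Δ)
∨-r d = ¬-r (∧-l (¬-l (¬-l d)))

-- Both premises stand on the left, so that after `to-⟹` the rule `□-K` can move them out into boxed
-- components.
detach : ∀ A B → ⊢H [ (A ⊃ B ∷ A ∷ []) ⟶ [ B ] ]
detach A B = ¬-l (∧-r (init A) (¬-r (init B)))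

modus-ponens : ∀ {A B} → ⊢H [ [] ⟶ [ A ] ] → ⊢H [ [] ⟶ [ A ⊃ B ] ] → ⊢H [ [] ⟶ [ B ] ]
modus-ponens {A} {B} d e = cut d (cut e (detach A B))

-- Kalmár's completeness argument for the propositional rules

-- Equality has to be decided because the valuation in `eliminate-atoms` tests membership in `Γ`. A
-- Boolean test covers all mismatched constructors by one clause.
_==_ : Formula → Formula → Bool
var p   == var q   = p ≡ᵇ q
⊥       == ⊥       = true
(¬ A)   == (¬ B)   = A == B
(A ∧ B) == (C ∧ D) = (A == C) Bool.∧ (B == D)
(■ A)   == (■ B)   = A == B
(□ A)   == (□ B)   = A == B
_       == _       = false

==⇒≡ : ∀ A B → T (A == B) → A ≡ B
==⇒≡ (var p) (var q) t = cong var (≡ᵇ⇒≡ p q t)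
==⇒≡ ⊥       ⊥       t = refl
==⇒≡ (¬ A)   (¬ B)   t = cong ¬_ (==⇒≡ A B t)
==⇒≡ (A ∧ B) (C ∧ D) t =
  let t₁ , t₂ = Equivalence.to T-∧ t in cong₂ _∧_ (==⇒≡ A C t₁) (==⇒≡ B D t₂)
==⇒≡ (■ A)   (■ B)   t = cong ■_ (==⇒≡ A B t)
==⇒≡ (□ A)   (□ B)   t = cong □_ (==⇒≡ A B t)

==-refl : ∀ A → T (A == A)
==-refl (var p) = ≡⇒≡ᵇ p p refl
==-refl ⊥       = _
==-refl (¬ A)   = ==-refl A
==-refl (A ∧ B) = Equivalence.from T-∧ (==-refl A , ==-refl B)
==-refl (■ A)   = ==-refl A
==-refl (□ A)   = ==-refl A

_≟_ : DecidableEquality Formula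
A ≟ B = map′ (==⇒≡ A B) (λ { refl → ==-refl A }) (Bool.T? (A == B))

open import Data.List.Membership.DecPropositional _≟_ using (_∈?_)

atoms : Formula → List Formula
atoms (var p) = [ var p ]
atoms ⊥       = []
atoms (¬ A)   = atoms A
atoms (A ∧ B) = atoms A ++ atoms B
atoms (■ A)   = [ ■ A ]
atoms (□ A)   = [ □ A ]

Literal : List Formula → List Formula → Bool → Formula → Set
Literal Γ Δ b A = if b then A ∈ Γ else A ∈ Δ

Settled : List Formula → List Formula → Bool → Formula → Set
Settled Γ Δ true  A = ⊢H [ Γ ⟶ (A ∷ Δ) ]
Settled Γ Δ false A = ⊢H [ (A ∷ Γ) ⟶ Δ ]

module _ {Γ Δ : List Formula} where

  settle-literal : ∀ b {A} → Literal Γ Δ b A → Settled Γ Δ b A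
  settle-literal true  A∈Γ = structural (λ { (here refl) → A∈Γ }) (λ { (here p) → here p }) (init _)
  settle-literal false A∈Δ = structural (λ { (here p) → here p }) (λ { (here refl) → A∈Δ }) (init _)

  settle-¬ : ∀ b {A} → Settled Γ Δ b A → Settled Γ Δ (Bool.not b) (¬ A)
  settle-¬ true  d = ¬-l d
  settle-¬ false d = ¬-r d

  settle-∧ : ∀ b c {A B} → Settled Γ Δ b A → Settled Γ Δ c B → Settled Γ Δ (b Bool.∧ c) (A ∧ B)
  settle-∧ true  true  d e = ∧-r⁺ d e
  settle-∧ true  false d e = ∧-l₂ e
  settle-∧ false c     d e = ∧-l₁ d

  -- Kalmár's lemma by induction on `A`, with the two sides of the sequent in place of positive and
  -- negated atoms.
  settle : ∀ v A → All (λ x → Literal Γ Δ (v x) x) (atoms A) → Settled Γ Δ (eval v A) A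
  settle v (var p) (l ∷ []) = settle-literal (v (var p)) l
  settle v ⊥       ls       = structural (λ { (here p) → here p }) (λ ()) ⊥-l
  settle v (¬ A)   ls       = settle-¬ (eval v A) (settle v A ls)
  settle v (A ∧ B) ls       =
    settle-∧ (eval v A) (eval v B) (settle v A (All.++⁻ˡ (atoms A) ls))
                                   (settle v B (All.++⁻ʳ (atoms A) ls))
  settle v (■ A)   (l ∷ []) = settle-literal (v (■ A)) l
  settle v (□ A)   (l ∷ []) = settle-literal (v (□ A)) l

∈-literal : ∀ {Γ Δ x} → x ∈ Γ ⊎ x ∈ Δ → Literal Γ Δ (does (x ∈? Γ)) x
∈-literal {Γ} {x = x} p with x ∈? Γ
... | yes x∈Γ = x∈Γ
... | no  x∉Γ = case p of λ { (inj₁ x∈Γ) → case x∉Γ x∈Γ of λ () ; (inj₂ x∈Δ) → x∈Δ }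

-- `L` lists the atoms not yet placed. A cut on each puts it on the right in one premise and on the
-- left in the other; once `L` is empty, the context is one row of the truth table.
eliminate-atoms : ∀ {A} → Tautology A → ∀ L {Γ Δ} →
                  All (λ x → x ∈ L ⊎ x ∈ Γ ⊎ x ∈ Δ) (atoms A) → ⊢H [ Γ ⟶ (A ∷ Δ) ]
eliminate-atoms {A} t [] {Γ} {Δ} cover =
  -- Since `A` is a tautology, its value at `v` is `true`, so `settle` yields `A` on the right.
  subst (λ b → Settled Γ Δ b A) (t v) (settle v A (All.map (λ { (inj₂ p) → ∈-literal p }) cover))
  where v = λ x → does (x ∈? Γ)
eliminate-atoms t (x ∷ L) cover = cut⁺
  (reorder ↭.refl (↭.swap _ _ ↭.refl) (eliminate-atoms t L (All.map right cover)))
  (eliminate-atoms t L (All.map left cover))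
  where
  left : ∀ {y Γ Δ} → y ∈ x ∷ L ⊎ y ∈ Γ ⊎ y ∈ Δ → y ∈ L ⊎ y ∈ x ∷ Γ ⊎ y ∈ Δ
  left (inj₁ (here p))  = inj₂ (inj₁ (here p))
  left (inj₁ (there p)) = inj₁ p
  left (inj₂ p)         = inj₂ (Sum.map₁ there p)

  right : ∀ {y Γ Δ} → y ∈ x ∷ L ⊎ y ∈ Γ ⊎ y ∈ Δ → y ∈ L ⊎ y ∈ Γ ⊎ y ∈ x ∷ Δ
  right (inj₁ (here p))  = inj₂ (inj₂ (here p))
  right (inj₁ (there p)) = inj₁ p
  right (inj₂ p)         = inj₂ (Sum.map₂ there p)

tautology⇒⊢H : ∀ {A} → Tautology A → ⊢H [ [] ⟶ [ A ] ]
tautology⇒⊢H {A} t = eliminate-atoms t (atoms A) (All.tabulate inj₁)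

-- From GR_AX to GR_H

init⟹ : ∀ A → ⊢H [ [ A ] ⟹ [ A ] ]
init⟹ A = to-⟹ (init A)

merge-□ : ∀ {A B} → ⊢H [] ∣ [ B ] ⟶ [] ∣ [] ⟹ [ A ] → ⊢H [ [ B ] ⟶ [ □ A ] ]
merge-□ d = merge (□-r (iw-l d))

⊢AX⇒⊢H : ∀ {A} → ⊢AX A → ⊢H [ [] ⟶ [ A ] ]
⊢AX⇒⊢H (taut t)  = tautology⇒⊢H t
⊢AX⇒⊢H (ax2 A B) =
  ⊃-r (⊃-r (merge (merge (swap (□-r (iw-l (□-K (□-K
    (to-⟹ (reorder (↭.swap _ _ ↭.refl) ↭.refl (detach A B)))))))))))
-- The `□ A` that `detach` leaves on the left is the diagonal formula discharged by `□-r`.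
⊢AX⇒⊢H (ax3 A)   = ⊃-r (merge (□-r (□-K (to-⟹ (detach (□ A) A)))))
⊢AX⇒⊢H (ax4 A)   = ⊃-r (merge-□ (■-K (init⟹ A)))
⊢AX⇒⊢H (ax5 A)   = ⊃-r (merge-□ (■-r₂ (□-K (init⟹ A))))
-- The empty ⟹-component created by `■-r₁` is weakened to `□ ⊥ ⟹ ⊥`, from which `□-r` gives the
-- other disjunct `□ ⊥`.
⊢AX⇒⊢H (ax6 A)   =
  ⊃-r (∨-r (merge (swap (merge (□-r (iw-l (iw-r (■-r₁ (iw-l (□-K (init⟹ A)))))))))))
-- The contrapositive `□ ¬ A ⟶ □ ¬ ■ A` is derived first. `□-K` must precede `■-l`, which allows no
-- other formula in its component.
⊢AX⇒⊢H (ax7 A)   =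
  ⊃-r (¬-r (reorder (↭.swap _ _ ↭.refl) ↭.refl
    (¬-l (merge-□ (¬-r (■-l (□-K (¬-l (init⟹ A)))))))))
⊢AX⇒⊢H (mp d e)  = modus-ponens (⊢AX⇒⊢H d) (⊢AX⇒⊢H e)
⊢AX⇒⊢H (nec d)   = □-r (iw-l (to-⟹ (⊢AX⇒⊢H d)))
-- Cutting `□ A` empties the ⟶-component; `⊥-ext` drops it and leaves only `⟹ A`.
⊢AX⇒⊢H (den {A} d) = to-⟶ (⊥-ext (cut (⊢AX⇒⊢H d) (swap (□-K (init⟹ A)))))

-- From GR_H to GR_AX

infix 4 _⊨_ _⊩_
infix 22 _▷_

-- Propositional reasoning in GR_AX through valuations

_⊨_ : (Formula → Bool) → Formula → Set
v ⊨ A = T (eval v A)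

⊃⁺ : ∀ v A B → (v ⊨ A → v ⊨ B) → v ⊨ A ⊃ B
⊃⁺ v A B f with eval v A | eval v B
... | false | _     = _
... | true  | true  = _
... | true  | false = f _

⊃⁻ : ∀ v A B → v ⊨ A ⊃ B → v ⊨ A → v ⊨ B
⊃⁻ v A B t a with eval v A | eval v B
... | true | true = _

∨⁺ : ∀ v A B → v ⊨ A ⊎ v ⊨ B → v ⊨ A ∨ B
∨⁺ v A B p with eval v A | eval v B
... | true  | _     = _
... | false | true  = _
... | false | false = [ id , id ]′ p

∨⁻ : ∀ v A B → v ⊨ A ∨ B → v ⊨ A ⊎ v ⊨ B
∨⁻ v A B t with eval v A | eval v B
... | true  | _    = inj₁ _
... | false | true = inj₂ _

¬⁺ : ∀ v A → (v ⊨ A → v ⊨ ⊥) → v ⊨ ¬ A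
¬⁺ v A f with eval v A
... | false = _
... | true  = f _

¬⁻ : ∀ v A → v ⊨ ¬ A → v ⊨ A → v ⊨ ⊥
¬⁻ v A t a with eval v A
... | true = t

excluded-middle : ∀ v A → v ⊨ A ⊎ v ⊨ ¬ A
excluded-middle v A with eval v A
... | true  = inj₁ _
... | false = inj₂ _

-- The implication from `Ps` to `C` is a tautology, and `mp` discharges the members of `Ps` one by
-- one. Propositional steps thereby become arguments about valuations.
infer : ∀ {Ps C} → All ⊢AX_ Ps → (∀ v → All (v ⊨_) Ps → v ⊨ C) → ⊢AX C
infer []       f = taut (λ v → Equivalence.to T-≡ (f v []))
infer {P ∷ _} {C} (p ∷ ps) f =
  mp p (infer ps (λ v qs → ⊃⁺ v P C (λ q → f v (q ∷ qs))))

tautology₁ : ∀ {A B} → (∀ v → v ⊨ A → v ⊨ B) → ⊢AX A ⊃ B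
tautology₁ {A} {B} f = infer [] (λ { v [] → ⊃⁺ v A B (f v) })

tautology₂ : ∀ {A B C} → (∀ v → v ⊨ A → v ⊨ B → v ⊨ C) → ⊢AX A ⊃ B ⊃ C
tautology₂ {A} {B} {C} f = tautology₁ (λ v a → ⊃⁺ v B C (f v a))

⊃-trans : ∀ {A B C} → ⊢AX A ⊃ B → ⊢AX B ⊃ C → ⊢AX A ⊃ C
⊃-trans {A} {B} {C} p q = infer (p ∷ q ∷ [])
  (λ { v (f ∷ g ∷ []) → ⊃⁺ v A C (⊃⁻ v B C g ∘ ⊃⁻ v A B f) })

□-mono : ∀ {A B} → ⊢AX A ⊃ B → ⊢AX □ A ⊃ □ B
□-mono p = mp (nec p) (ax2 _ _)

-- Löb's axiom at A ∧ □ A.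
□-transitive : ∀ A → ⊢AX □ A ⊃ □ □ A
□-transitive A = ⊃-trans (⊃-trans (□-mono A⊃□B⊃B) (ax3 B)) (□-mono (tautology₁ (λ v → ∧⁻₂ v A (□ A))))
  where
  B = A ∧ □ A
  ∧⁻₂ : ∀ v A B → v ⊨ A ∧ B → v ⊨ B
  ∧⁻₂ v A B t = proj₂ (Equivalence.to (T-∧ {eval v A}) t)
  A⊃□B⊃B : ⊢AX A ⊃ □ B ⊃ B
  A⊃□B⊃B = infer (□-mono (tautology₁ {B} {A} (λ v → proj₁ ∘ Equivalence.to T-∧)) ∷ [])
    (λ { v (f ∷ []) → ⊃⁺ v A (□ B ⊃ B) (λ a → ⊃⁺ v (□ B) B (λ b →
      Equivalence.from T-∧ (a , ⊃⁻ v (□ B) (□ A) f b))) })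

-- Sequents as formulas

⋀ ⋁ : List Formula → Formula
⋀ []      = ¬ ⊥
⋀ (A ∷ Γ) = A ∧ ⋀ Γ
⋁ []      = ⊥
⋁ (A ∷ Δ) = A ∨ ⋁ Δ

⋀⁺ : ∀ v {Γ} → All (v ⊨_) Γ → v ⊨ ⋀ Γ
⋀⁺ v []       = _
⋀⁺ v (a ∷ as) = Equivalence.from T-∧ (a , ⋀⁺ v as)

⋀⁻ : ∀ v Γ → v ⊨ ⋀ Γ → All (v ⊨_) Γ
⋀⁻ v []      t = []
⋀⁻ v (A ∷ Γ) t = let t₁ , t₂ = Equivalence.to T-∧ t in t₁ ∷ ⋀⁻ v Γ t₂

⋁⁺ : ∀ v {Δ} → Any (v ⊨_) Δ → v ⊨ ⋁ Δ
⋁⁺ v {A ∷ Δ} (here a)   = ∨⁺ v A (⋁ Δ) (inj₁ a)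
⋁⁺ v {A ∷ Δ} (there as) = ∨⁺ v A (⋁ Δ) (inj₂ (⋁⁺ v as))

⋁⁻ : ∀ v Δ → v ⊨ ⋁ Δ → Any (v ⊨_) Δ
⋁⁻ v (A ∷ Δ) t = [ here , there ∘ ⋁⁻ v Δ ]′ (∨⁻ v A (⋁ Δ) t)

_▷_ : List Formula → List Formula → Formula
Γ ▷ Δ = ⋀ Γ ⊃ ⋁ Δ

-- The truth of `Γ ▷ Δ` in list form: contexts are split and joined by operations on `All` and `Any`
-- instead of nested connectives.
Satisfies : (Formula → Bool) → List Formula → List Formula → Set
Satisfies v Γ Δ = All (v ⊨_) Γ → Any (v ⊨_) Δ

▷⁺ : ∀ v {Γ Δ} → Satisfies v Γ Δ → v ⊨ Γ ▷ Δ
▷⁺ v {Γ} {Δ} f = ⊃⁺ v (⋀ Γ) (⋁ Δ) (⋁⁺ v ∘ f ∘ ⋀⁻ v Γ)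

▷⁻ : ∀ v Γ Δ → v ⊨ Γ ▷ Δ → Satisfies v Γ Δ
▷⁻ v Γ Δ t = ⋁⁻ v Δ ∘ ⊃⁻ v (⋀ Γ) (⋁ Δ) t ∘ ⋀⁺ v

modal : Arrow → Formula → Formula
modal single A = A
modal double A = □ A

⟦_⟧ : Sequent → Formula
⟦ Γ ⟨ a ⟩ Δ ⟧ = modal a (Γ ▷ Δ)

modal-map : ∀ a {A B} → ⊢AX A ⊃ B → ⊢AX modal a A ⊃ modal a B
modal-map single p = p
modal-map double p = □-mono p

-- Necessitation and two uses of axiom 2 carry the implication under the box, so one propositional
-- check serves both arrows.
modal-map₂ : ∀ a {A B C} → ⊢AX A ⊃ B ⊃ C → ⊢AX modal a A ⊃ modal a B ⊃ modal a C
modal-map₂ single p = p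
modal-map₂ double p = ⊃-trans (□-mono p) (ax2 _ _)

sequent₁ : ∀ a {Γ Δ Γ′ Δ′} → (∀ v → Satisfies v Γ Δ → Satisfies v Γ′ Δ′) →
           ⊢AX ⟦ Γ ⟨ a ⟩ Δ ⟧ ⊃ ⟦ Γ′ ⟨ a ⟩ Δ′ ⟧
sequent₁ a {Γ} {Δ} f = modal-map a (tautology₁ (λ v → ▷⁺ v ∘ f v ∘ ▷⁻ v Γ Δ))

sequent₂ : ∀ a {Γ Δ Π Θ Γ′ Δ′} → (∀ v → Satisfies v Γ Δ → Satisfies v Π Θ → Satisfies v Γ′ Δ′) →
           ⊢AX ⟦ Γ ⟨ a ⟩ Δ ⟧ ⊃ ⟦ Π ⟨ a ⟩ Θ ⟧ ⊃ ⟦ Γ′ ⟨ a ⟩ Δ′ ⟧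
sequent₂ a {Γ} {Δ} {Π} {Θ} f =
  modal-map₂ a (tautology₂ (λ v s t → ▷⁺ v (f v (▷⁻ v Γ Δ s) (▷⁻ v Π Θ t))))

-- Hypersequents as disjunctions

Provable : Hypersequent → Set
Provable H = ⊢AX ⋁ (map ⟦_⟧ H)

_⊩_ : (Formula → Bool) → Hypersequent → Set
v ⊩ H = Any (λ S → v ⊨ ⟦ S ⟧) H

⊩⁺ : ∀ v {H} → v ⊩ H → v ⊨ ⋁ (map ⟦_⟧ H)
⊩⁺ v = ⋁⁺ v ∘ Any.map⁺

⊩⁻ : ∀ v H → v ⊨ ⋁ (map ⟦_⟧ H) → v ⊩ H
⊩⁻ v H = Any.map⁻ ∘ ⋁⁻ v (map ⟦_⟧ H)

-- To a valuation, boxed formulas are unrelated atoms; the modal facts behind a rule therefore enter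
-- as the theorems `Ps`.
rule : ∀ {Ps H I} → All ⊢AX_ Ps → (∀ v → All (v ⊨_) Ps → v ⊩ H → v ⊩ I) →
       Provable H → Provable I
rule {H = H} ps f d = infer (d ∷ ps) (λ { v (h ∷ qs) → ⊩⁺ v (f v qs (⊩⁻ v H h)) })

replace : ∀ {S T H} → ⊢AX ⟦ S ⟧ ⊃ ⟦ T ⟧ → Provable (H ∣ S) → Provable (H ∣ T)
replace {S} {T} {H} p = rule {H = H ∣ S} {H ∣ T} (p ∷ []) λ
  { v (f ∷ []) (here s)  → here (⊃⁻ v ⟦ S ⟧ ⟦ T ⟧ f s)
  ; v (f ∷ []) (there h) → there h }

replace₂ : ∀ {S T U H I} → ⊢AX ⟦ S ⟧ ⊃ ⟦ T ⟧ ⊃ ⟦ U ⟧ →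
           Provable (H ∣ S) → Provable (I ∣ T) → Provable ((H ++ I) ∣ U)
replace₂ {S} {T} {U} {H} {I} p d e = infer (p ∷ d ∷ e ∷ [])
  (λ { v (f ∷ h ∷ i ∷ []) → ⊩⁺ v (combine v f (⊩⁻ v (H ∣ S) h) (⊩⁻ v (I ∣ T) i)) })
  where
  combine : ∀ v → v ⊨ ⟦ S ⟧ ⊃ ⟦ T ⟧ ⊃ ⟦ U ⟧ → v ⊩ H ∣ S → v ⊩ I ∣ T → v ⊩ (H ++ I) ∣ U
  combine v f (here s)  (here t)  = here (⊃⁻ v ⟦ T ⟧ ⟦ U ⟧ (⊃⁻ v ⟦ S ⟧ (⟦ T ⟧ ⊃ ⟦ U ⟧) f s) t)
  combine v f (there h) _         = there (Any.++⁺ˡ h)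
  combine v f (here _)  (there i) = there (Any.++⁺ʳ H i)

≈⇒⊃ : ∀ {S T} → S ≈ T → ⊢AX ⟦ S ⟧ ⊃ ⟦ T ⟧
≈⇒⊃ (perm a p q) = sequent₁ a (λ v f → Any-resp-↭ q ∘ f ∘ All-resp-↭ (↭.↭-sym p))

∨-mono : ∀ {A B C D} → ⊢AX A ⊃ C → ⊢AX B ⊃ D → ⊢AX A ∨ B ⊃ C ∨ D
∨-mono {A} {B} {C} {D} p q = infer (p ∷ q ∷ []) (λ { v (f ∷ g ∷ []) →
  ⊃⁺ v (A ∨ B) (C ∨ D) (∨⁺ v C D ∘ Sum.map (⊃⁻ v A C f) (⊃⁻ v B D g) ∘ ∨⁻ v A B) })

∨-exchange : ∀ A B C → ⊢AX A ∨ B ∨ C ⊃ B ∨ A ∨ C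
∨-exchange A B C = tautology₁ (λ v t → case ∨⁻ v A (B ∨ C) t of λ
  { (inj₁ a) → ∨⁺ v B (A ∨ C) (inj₂ (∨⁺ v A C (inj₁ a)))
  ; (inj₂ u) → ∨⁺ v B (A ∨ C) (Sum.map₂ (∨⁺ v A C ∘ inj₂) (∨⁻ v B C u)) })

-- An implication rather than preservation of provability, because the induction passes to tails of
-- the disjunction, which need not be provable.
≋⇒⊃ : ∀ {H I} → H ≋ I → ⊢AX ⋁ (map ⟦_⟧ H) ⊃ ⋁ (map ⟦_⟧ I)
≋⇒⊃ (Homogeneous.refl es)        = pointwise es
  where
  pointwise : ∀ {H I} → Pointwise _≈_ H I → ⊢AX ⋁ (map ⟦_⟧ H) ⊃ ⋁ (map ⟦_⟧ I)
  pointwise []       = tautology₁ (λ v → id)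
  pointwise (e ∷ es) = ∨-mono (≈⇒⊃ e) (pointwise es)
≋⇒⊃ (Homogeneous.prep e p)       = ∨-mono (≈⇒⊃ e) (≋⇒⊃ p)
≋⇒⊃ (Homogeneous.swap e₁ e₂ p) =
  ⊃-trans (∨-mono (≈⇒⊃ e₁) (∨-mono (≈⇒⊃ e₂) (≋⇒⊃ p))) (∨-exchange _ _ _)
≋⇒⊃ (Homogeneous.trans p q)      = ⊃-trans (≋⇒⊃ p) (≋⇒⊃ q)

-- Modal principles behind the rules

assuming : ∀ v A → v ⊨ A → v ⊨ [] ▷ [ A ]
assuming v A a = ▷⁺ v {[]} {[ A ]} (λ _ → here a)

conclude : ∀ v A → v ⊨ [] ▷ [ A ] → v ⊨ A
conclude v A t = case ▷⁻ v [] [ A ] t [] of λ { (here a) → a }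

refuting : ∀ v A → v ⊨ ¬ A → v ⊨ [ A ] ▷ []
refuting v A n = ▷⁺ v {[ A ]} {[]} (λ { (a ∷ []) → ⊥-elim (¬⁻ v A n a) })

singleton⁺ : ∀ S → ⊢AX ⟦ S ⟧ → Provable [ S ]
singleton⁺ S p = infer (p ∷ []) (λ { v (s ∷ []) → ⊩⁺ v {[ S ]} (here s) })

singleton⁻ : ∀ S → Provable [ S ] → ⊢AX ⟦ S ⟧
singleton⁻ S d = infer (d ∷ []) (λ { v (t ∷ []) → case ⊩⁻ v [ S ] t of λ { (here s) → s } })

-- Up to the units of `⋀` and `⋁`, the component reads `□ (□ A ⊃ A)`. It is the active premise of
-- both `□-r` and `■-r₁`.
löb : ∀ A → ⊢AX ⟦ [ □ A ] ⟹ [ A ] ⟧ ⊃ □ A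
löb A = ⊃-trans
  (□-mono (tautology₁ (λ v t → ⊃⁺ v (□ A) A
    (λ b → case ▷⁻ v [ □ A ] [ A ] t (b ∷ []) of λ { (here a) → a }))))
  (ax3 A)

-- One argument for `□-K`, `□-4`, `■-K` and `■-4`, which differ only in the theorem `B ⊃ □ A`. If
-- `B` is true, axiom 2 removes `A` from the boxed component; otherwise the component `B ⟶` is true.
unbox : ∀ {H A B Γ Δ} → ⊢AX B ⊃ □ A →
        Provable (H ∣ (A ∷ Γ) ⟹ Δ) → Provable (H ∣ [ B ] ⟶ [] ∣ Γ ⟹ Δ)
unbox {H} {A} {B} {Γ} {Δ} p =
  rule {H = H ∣ (A ∷ Γ) ⟹ Δ} {H ∣ [ B ] ⟶ [] ∣ Γ ⟹ Δ} (p ∷ q ∷ []) λ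
    { v (f ∷ g ∷ []) (here t)  → case excluded-middle v B of λ
        { (inj₁ b) → here (⊃⁻ v (□ ((A ∷ Γ) ▷ Δ)) (□ (Γ ▷ Δ))
                             (⊃⁻ v (□ A) (□ ((A ∷ Γ) ▷ Δ) ⊃ □ (Γ ▷ Δ)) g (⊃⁻ v B (□ A) f b)) t)
        ; (inj₂ n) → there (here (refuting v B n)) }
    ; v _            (there h) → there (there h) }
  where
  q : ⊢AX □ A ⊃ □ ((A ∷ Γ) ▷ Δ) ⊃ □ (Γ ▷ Δ)
  q = modal-map₂ double (tautology₂ (λ v a t → ▷⁺ v {Γ} {Δ} (▷⁻ v (A ∷ Γ) Δ t ∘ (a ∷_))))

-- The form needed for `■-l`, whose components `A ⟹` and `■ A ⟹` amount to `□ ¬ A` and `□ ¬ ■ A`.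
contraposed-ax7 : ∀ A → ⊢AX □ ¬ A ⊃ □ ¬ ■ A
contraposed-ax7 A = infer (ax7 A ∷ []) (λ { v (f ∷ []) → ⊃⁺ v (□ ¬ A) (□ ¬ ■ A)
  (λ b → [ id , (λ n → ⊥-elim (¬⁻ v (□ ¬ A) (⊃⁻ v (◇ ■ A) (◇ A) f n) b)) ]′
    (excluded-middle v (□ ¬ ■ A))) })

-- Soundness of each rule

⊢H⇒Provable : ∀ {H} → ⊢H H → Provable H
⊢H⇒Provable (exch p d) = mp (⊢H⇒Provable d) (≋⇒⊃ p)
⊢H⇒Provable (init A) = singleton⁺ _ (infer [] (λ v _ → ▷⁺ v {[ A ]} {[ A ]} (λ { (a ∷ []) → here a })))
⊢H⇒Provable ⊥-l = singleton⁺ _ (infer [] (λ v _ → _))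
⊢H⇒Provable (∧-l₁ {a = a} d) = replace
  (sequent₁ a (λ { v f (c ∷ γ) → f (proj₁ (Equivalence.to T-∧ c) ∷ γ) })) (⊢H⇒Provable d)
⊢H⇒Provable (∧-l₂ {a = a} {A} d) = replace
  (sequent₁ a (λ { v f (c ∷ γ) → f (proj₂ (Equivalence.to (T-∧ {eval v A}) c) ∷ γ) }))
  (⊢H⇒Provable d)
⊢H⇒Provable (∧-r {a = a} {Γ = Γ} {Δ} d e) = replace₂
  (sequent₂ a (λ v f g γπ → case (f (All.++⁻ˡ Γ γπ) , g (All.++⁻ʳ Γ γπ)) of λ
    { (here x  , here y)  → here (Equivalence.from T-∧ (x , y))
    ; (there δ , _)       → there (Any.++⁺ˡ δ)
    ; (here _  , there θ) → there (Any.++⁺ʳ Δ θ) }))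
  (⊢H⇒Provable d) (⊢H⇒Provable e)
⊢H⇒Provable (¬-l {a = a} {A} d) = replace
  (sequent₁ a (λ { v f (n ∷ γ) → case f γ of λ
    { (here x)  → ⊥-elim (¬⁻ v A n x)
    ; (there δ) → δ } }))
  (⊢H⇒Provable d)
⊢H⇒Provable (¬-r {a = a} {A} d) = replace
  (sequent₁ a (λ v f γ → case excluded-middle v A of λ
    { (inj₁ x) → there (f (x ∷ γ))
    ; (inj₂ n) → here n }))
  (⊢H⇒Provable d)
⊢H⇒Provable (ic-l {a = a} d) = replace
  (sequent₁ a (λ { v f (x ∷ γ) → f (x ∷ x ∷ γ) })) (⊢H⇒Provable d)
⊢H⇒Provable (ic-r {a = a} d) = replace
  (sequent₁ a (λ v f γ → case f γ of λ
    { (here x)  → here x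
    ; (there δ) → δ }))
  (⊢H⇒Provable d)
⊢H⇒Provable (iw-l {a = a} d) = replace
  (sequent₁ a (λ { v f (_ ∷ γ) → f γ })) (⊢H⇒Provable d)
⊢H⇒Provable (iw-r {a = a} d) = replace
  (sequent₁ a (λ v f γ → there (f γ))) (⊢H⇒Provable d)
⊢H⇒Provable (cut {a = a} {Γ = Γ} {Δ} d e) = replace₂
  (sequent₂ a (λ v f g γπ → case f (All.++⁻ˡ Γ γπ) of λ
    { (here x)  → Any.++⁺ʳ Δ (g (x ∷ All.++⁻ʳ Γ γπ))
    ; (there δ) → Any.++⁺ˡ δ }))
  (⊢H⇒Provable d) (⊢H⇒Provable e)
⊢H⇒Provable (ew {H} S d) = rule {H = H} {H ∣ S} [] (λ v _ → there) (⊢H⇒Provable d)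
⊢H⇒Provable (split {H} {Γ} {Δ} {Θ} {Π} d) =
  rule {H = H ∣ (Γ ++ Θ) ⟶ (Δ ++ Π)} {H ∣ Γ ⟶ Δ ∣ Θ ⟶ Π} [] (λ
    -- Either `Γ ▷ Δ` is true, or all of `Γ` and none of `Δ` is, and then `Θ` forces a member of
    -- `Π`. No box intervenes, so the valuation decides this.
    { v _ (here t)  → case (excluded-middle v (⋀ Γ) , excluded-middle v (⋁ Δ)) of λ
        { (_      , inj₁ δ) → there (here (⊃⁺ v (⋀ Γ) (⋁ Δ) (λ _ → δ)))
        ; (inj₂ n , _)      → there (here (⊃⁺ v (⋀ Γ) (⋁ Δ) (⊥-elim ∘ ¬⁻ v (⋀ Γ) n)))
        ; (inj₁ γ , inj₂ n) → here (▷⁺ v (λ θ →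
            [ ⊥-elim ∘ ¬⁻ v (⋁ Δ) n ∘ ⋁⁺ v , id ]′
              (Any.++⁻ Δ (▷⁻ v (Γ ++ Θ) (Δ ++ Π) t (All.++⁺ (⋀⁻ v Γ γ) θ))))) }
    ; v _ (there h) → there (there h) })
  (⊢H⇒Provable d)
⊢H⇒Provable (merge {H} {a} {Γ} {Δ} {Θ} {Π} d) =
  rule {H = H ∣ Γ ⟨ a ⟩ Δ ∣ Θ ⟨ a ⟩ Π} {H ∣ (Γ ++ Θ) ⟨ a ⟩ (Δ ++ Π)}
    -- Each component alone implies the merged one by weakening, also under the box.
    (sequent₁ a {Γ} {Δ} (λ v f → Any.++⁺ˡ ∘ f ∘ All.++⁻ˡ Γ) ∷
     sequent₁ a {Θ} {Π} (λ v f → Any.++⁺ʳ Δ ∘ f ∘ All.++⁻ʳ Γ) ∷ [])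
    (λ { v (f ∷ g ∷ []) (here t)          → here (⊃⁻ v ⟦ Θ ⟨ a ⟩ Π ⟧ M g t)
       ; v (f ∷ g ∷ []) (there (here t))  → here (⊃⁻ v ⟦ Γ ⟨ a ⟩ Δ ⟧ M f t)
       ; v _            (there (there h)) → there h })
    (⊢H⇒Provable d)
  where M = ⟦ (Γ ++ Θ) ⟨ a ⟩ (Δ ++ Π) ⟧
⊢H⇒Provable (⊥-ext {H} {Γ} {Δ} d) =
  -- The empty ⟶-component reads `¬ ⊥ ⊃ ⊥`, which evaluates to `false`, so the case `here` is
  -- impossible.
  rule {H = H ∣ Γ ⟹ Δ ∣ [] ⟶ []} {H ∣ Γ ⟹ Δ} [] (λ { v _ (there h) → h }) (⊢H⇒Provable d)
⊢H⇒Provable (□-K d) = unbox (tautology₁ (λ v → id)) (⊢H⇒Provable d)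
⊢H⇒Provable (□-4 d) = unbox (□-transitive _) (⊢H⇒Provable d)
⊢H⇒Provable (□-r {A = A} d) =
  replace (⊃-trans (löb A) (tautology₁ (λ v → assuming v (□ A)))) (⊢H⇒Provable d)
⊢H⇒Provable (■-K d) = unbox (ax4 _) (⊢H⇒Provable d)
⊢H⇒Provable (■-4 d) = unbox (⊃-trans (ax4 _) (ax5 _)) (⊢H⇒Provable d)
⊢H⇒Provable (■-r₁ {H} {A} d) =
  rule {H = H ∣ [ □ A ] ⟹ [ A ]} {H ∣ [] ⟶ [ ■ A ] ∣ [] ⟹ []}
    (⊃-trans (löb A) (ax6 A) ∷ □-mono {⊥} {[] ▷ []} (tautology₁ (λ v ())) ∷ [])
    (λ { v (f ∷ g ∷ []) (here t) →
           case ∨⁻ v (□ ⊥) (■ A) (⊃⁻ v ⟦ [ □ A ] ⟹ [ A ] ⟧ (□ ⊥ ∨ ■ A) f t) of λ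
             { (inj₁ b) → here (⊃⁻ v (□ ⊥) ⟦ [] ⟹ [] ⟧ g b)
             ; (inj₂ b) → there (here (assuming v (■ A) b)) }
       ; v _ (there h) → there (there h) })
    (⊢H⇒Provable d)
⊢H⇒Provable (■-l {A = A} d) = replace
  (⊃-trans (□-mono (tautology₁ (λ v t → ¬⁺ v A
      (λ a → case ▷⁻ v [ A ] [] t (a ∷ []) of λ ()))))
    (⊃-trans (contraposed-ax7 A) (□-mono (tautology₁ (λ v → refuting v (■ A))))))
  (⊢H⇒Provable d)
⊢H⇒Provable (■-r₂ {A = A} d) = replace
  (⊃-trans (□-mono (tautology₁ (λ v → conclude v A)))
    (⊃-trans (ax5 A) (□-mono (tautology₁ (λ v → assuming v (■ A))))))
  (⊢H⇒Provable d)
-- Without side components the sequent's own formula is provable, so `nec` applies here and `den` in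
-- the next case.
⊢H⇒Provable (to-⟹ {Γ} {Δ} d) = singleton⁺ (Γ ⟹ Δ) (nec (singleton⁻ (Γ ⟶ Δ) (⊢H⇒Provable d)))
⊢H⇒Provable (to-⟶ {Γ} {Δ} d) = singleton⁺ (Γ ⟶ Δ) (den (singleton⁻ (Γ ⟹ Δ) (⊢H⇒Provable d)))

⊢H⇒⊢AX : ∀ {A} → ⊢H [ [] ⟶ [ A ] ] → ⊢AX A
⊢H⇒⊢AX {A} d = infer (singleton⁻ _ (⊢H⇒Provable d) ∷ []) (λ { v (t ∷ []) → conclude v A t })

theorem2p1 : (A : Formula) → (⊢AX A) ⇔ (⊢H [ [] ⟶ [ A ] ])
theorem2p1 A = mk⇔ ⊢AX⇒⊢H ⊢H⇒⊢AX
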